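{- Let $\alpha=\frac{2\pi}{3}$ and let $\alpha,\beta,\gamma,\delta$ be distinct. The spherical tiling by $12$ angle congruent pentagons with angles $\alpha,\alpha,\beta,\gamma,\delta$ is, up to symmetry, given by the following (angle words on the dodecahedral pattern, as explained in the context): $P_1:\delta\alpha\beta\gamma\alpha$; $P_2:\alpha\delta\alpha\beta\gamma$; $P_3:\beta\gamma\alpha\delta\alpha$; $P_4:\alpha\beta\gamma\alpha\delta$; $P_5:\gamma\alpha\delta\alpha\beta$; $P_6:\delta\alpha\beta\gamma\alpha$; $P_7:\gamma\alpha\delta\alpha\beta$; $P_8:\alpha\beta\gamma\alpha\delta$; $P_9:\beta\gamma\alpha\delta\alpha$; $P_{10}:\alpha\delta\alpha\beta\gamma$; $P_{11}:\delta\alpha\beta\gamma\alpha$; $P_{12}:\gamma\alpha\delta\alpha\beta$; where, around any of the six edges $E_{1,5},E_{2,3},E_{4,8},E_{6,11},E_{7,12},E_{9,10}$ (independently), one can exchange the four angles $\beta$ and $\gamma$ around that edge and still get a tiling; the tilings so obtained are included.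
   Context: A spherical tiling by $12$ pentagons (graph embedded in $S^2$ with all vertices of degree $\ge 3$, every tile a five-edged region enclosed by a simple closed curve; edges may be any nice curves) is combinatorially the dodecahedral pattern: tiles $P_1,\dots,P_{12}$, where $P_i$ with list $(n_1,\dots,n_5)$ has edges in counterclockwise order $E_{i,n_1},\dots,E_{i,n_5}$, $E_{i,j}=E_{j,i}$ being the common edge of $P_i$ and $P_j$, and (with $n_6=n_1$) $E_{i,n_k},E_{i,n_{k+1}}$ meet at the vertex $V_{i,n_k,n_{k+1}}$ of degree $3$ shared by $P_i,P_{n_k},P_{n_{k+1}}$: $P_1:(2,3,4,5,6)$; $P_2:(1,6,11,7,3)$; $P_3:(1,2,7,8,4)$; $P_4:(1,3,8,9,5)$; $P_5:(1,4,9,10,6)$; $P_6:(1,5,10,11,2)$; $P_7:(12,8,3,2,11)$; $P_8:(12,9,4,3,7)$; $P_9:(12,10,5,4,8)$; $P_{10}:(12,11,6,5,9)$; $P_{11}:(12,7,2,6,10)$; $P_{12}:(7,11,10,9,8)$. "$P_i:w_1w_2w_3w_4w_5$" means that the angle of $P_i$ at $V_{i,n_k,n_{k+1}}$ is $w_k$ for $k=1,\dots,5$. An angle congruent tiling is considered as an assignment of angles to all (tile, vertex) corners such that the angles at every vertex sum to $2\pi$ and any two tiles are angle congruent, i.e. there is an adjacency-preserving correspondence of their edges that preserves the angles between adjacent edges (reflections allowed). No geometric realization by great arcs is required. The four angles around an edge $E_{i,j}$ are the angles of $P_i$ and of $P_j$ at the two end vertices of $E_{i,j}$; exchanging $\beta$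 and $\gamma$ around it means replacing $\beta$ by $\gamma$ and $\gamma$ by $\beta$ in these four corners. "Up to symmetry" means up to symmetries of the dodecahedral pattern (including reflections) and up to permuting the names $\beta,\gamma,\delta$. -}

module Defs where

open import Level using (Level; _⊔_)
open import Algebra.Apartness.Bundles using (HeytingField; HeytingCommutativeRing)
open import Algebra.Bundles using (CommutativeRing)
import Algebra.Definitions.RawMonoid as RawMonoidDefs
open import Data.Bool.Base using (Bool; if_then_else_)
open import Data.Fin.Base using (Fin; suc)
open import Data.Fin.Patterns
open import Data.Fin.Permutation using (Permutation′; _⟨$⟩ʳ_)
open import Data.Fin.Properties using (_≟_)
open import Data.Nat.Base using (ℕ; suc)
open import Data.Product.Base using (Σ; _×_; _,_)
open import Data.Sum.Base using (_⊎_)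
open import Data.Vec.Base using (Vec; []; _∷_; lookup; zip; foldr′)
open import Function.Bundles using (_↔_; Inverse)
open import Relation.Binary.PropositionalEquality using (_≡_)
open import Relation.Nullary using (Dec; does; _×-dec_; _⊎-dec_)

Tile : Set
Tile = Fin 12

pattern P₁  = 0F
pattern P₂  = 1F
pattern P₃  = 2F
pattern P₄  = 3F
pattern P₅  = 4F
pattern P₆  = 5F
pattern P₇  = 6F
pattern P₈  = 7F
pattern P₉  = 8F
pattern P₁₀ = 9F
pattern P₁₁ = suc 9F
pattern P₁₂ = suc (suc 9F)

next : Fin 5 → Fin 5
next 0F = 1F
next 1F = 2F
next 2F = 3F
next 3F = 4F
next 4F = 0F

neighbours : Vec (Vec Tile 5) 12
neighbours =
    (P₂  ∷ P₃  ∷ P₄  ∷ P₅  ∷ P₆  ∷ [])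
  ∷ (P₁  ∷ P₆  ∷ P₁₁ ∷ P₇  ∷ P₃  ∷ [])
  ∷ (P₁  ∷ P₂  ∷ P₇  ∷ P₈  ∷ P₄  ∷ [])
  ∷ (P₁  ∷ P₃  ∷ P₈  ∷ P₉  ∷ P₅  ∷ [])
  ∷ (P₁  ∷ P₄  ∷ P₉  ∷ P₁₀ ∷ P₆  ∷ [])
  ∷ (P₁  ∷ P₅  ∷ P₁₀ ∷ P₁₁ ∷ P₂  ∷ [])
  ∷ (P₁₂ ∷ P₈  ∷ P₃  ∷ P₂  ∷ P₁₁ ∷ [])
  ∷ (P₁₂ ∷ P₉  ∷ P₄  ∷ P₃  ∷ P₇  ∷ [])
  ∷ (P₁₂ ∷ P₁₀ ∷ P₅  ∷ P₄  ∷ P₈  ∷ [])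
  ∷ (P₁₂ ∷ P₁₁ ∷ P₆  ∷ P₅  ∷ P₉  ∷ [])
  ∷ (P₁₂ ∷ P₇  ∷ P₂  ∷ P₆  ∷ P₁₀ ∷ [])
  ∷ (P₇  ∷ P₁₁ ∷ P₁₀ ∷ P₉  ∷ P₈  ∷ [])
  ∷ []

-- The k-th edge of tile i is the one shared with  nbr i k.  The k-th corner
-- of tile i lies between its edges k and  next k,  that is, at the vertex
-- shared by i,  nbr i k  and  nbr i (next k).
nbr : Tile → Fin 5 → Tile
nbr i k = lookup (lookup neighbours i) k

-- Corner k of tile i is at the vertex V i j l, in this orientation.
At : Tile → Tile → Tile → Fin 5 → Set
At i j l k = nbr i k ≡ j × nbr i (next k) ≡ l

-- A symmetry of the pattern, reflections included.  The corner map is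
-- determined by the tile map, since the neighbours of a tile are distinct;
-- it is a field only for convenience.
record Symmetry : Set where
  field
    tile     : Permutation′ 12
    corner   : Tile → Fin 5 → Fin 5

  σ : Tile → Tile
  σ i = tile ⟨$⟩ʳ i

  field
    preserve : ∀ i k →
      At (σ i) (σ (nbr i k)) (σ (nbr i (next k))) (corner i k) ⊎
      At (σ i) (σ (nbr i (next k))) (σ (nbr i k)) (corner i k)

data Angle : Set where
  α β γ δ : Angle

record Renaming : Set where
  field
    perm  : Angle ↔ Angle
    fix-α : Inverse.to perm α ≡ α

  rename : Angle → Angle
  rename = Inverse.to perm

Labelling : Set
Labelling = Tile → Fin 5 → Angle

baseWords : Vec (Vec Angle 5) 12
baseWords =
    (δ ∷ α ∷ β ∷ γ ∷ α ∷ [])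
  ∷ (α ∷ δ ∷ α ∷ β ∷ γ ∷ [])
  ∷ (β ∷ γ ∷ α ∷ δ ∷ α ∷ [])
  ∷ (α ∷ β ∷ γ ∷ α ∷ δ ∷ [])
  ∷ (γ ∷ α ∷ δ ∷ α ∷ β ∷ [])
  ∷ (δ ∷ α ∷ β ∷ γ ∷ α ∷ [])
  ∷ (γ ∷ α ∷ δ ∷ α ∷ β ∷ [])
  ∷ (α ∷ β ∷ γ ∷ α ∷ δ ∷ [])
  ∷ (β ∷ γ ∷ α ∷ δ ∷ α ∷ [])
  ∷ (α ∷ δ ∷ α ∷ β ∷ γ ∷ [])
  ∷ (δ ∷ α ∷ β ∷ γ ∷ α ∷ [])
  ∷ (γ ∷ α ∷ δ ∷ α ∷ β ∷ [])
  ∷ []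

base : Labelling
base i k = lookup (lookup baseWords i) k

swapβγ : Angle → Angle
swapβγ α = α
swapβγ β = γ
swapβγ γ = β
swapβγ δ = δ

Edge : Set
Edge = Tile × Tile

-- Corner k of tile t is one of the four corners around the edge E i j.
Around : Edge → Tile → Fin 5 → Set
Around (i , j) t k =
  (t ≡ i × (nbr t k ≡ j ⊎ nbr t (next k) ≡ j)) ⊎
  (t ≡ j × (nbr t k ≡ i ⊎ nbr t (next k) ≡ i))

around? : ∀ e t k → Dec (Around e t k)
around? (i , j) t k =
  (t ≟ i ×-dec (nbr t k ≟ j ⊎-dec nbr t (next k) ≟ j)) ⊎-dec
  (t ≟ j ×-dec (nbr t k ≟ i ⊎-dec nbr t (next k) ≟ i))

exchange : Edge → Labelling → Labelling
exchange e L t k = if does (around? e t k) then swapβγ (L t k) else L t k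

exchangeEdges : Vec Edge 6
exchangeEdges =
    (P₁ , P₅) ∷ (P₂ , P₃) ∷ (P₄ , P₈) ∷ (P₆ , P₁₁) ∷ (P₇ , P₁₂) ∷ (P₉ , P₁₀) ∷ []

-- The base labelling after the exchanges around the edges selected by S.
exchanged : Vec Bool 6 → Labelling
exchanged S =
  foldr′ (λ { (b , e) L → if b then exchange e L else L }) base (zip S exchangeEdges)

-- In the absence of ℝ, angles take values in a Heyting field of characteristic
-- zero (ℝ is an example), with π an arbitrary element: all that is used of π
-- is that the full angle is 2 · π.

module Multiple {c ℓ₁ ℓ₂ : Level} (F : HeytingField c ℓ₁ ℓ₂) where
  open HeytingField F using (Carrier; heytingCommutativeRing)

  infixr 8 _·_

  _·_ : ℕ → Carrier → Carrier
  _·_ = RawMonoidDefs._×_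
    (CommutativeRing.+-rawMonoid
      (HeytingCommutativeRing.commutativeRing heytingCommutativeRing))

CharacteristicZero : {c ℓ₁ ℓ₂ : Level} → HeytingField c ℓ₁ ℓ₂ → Set ℓ₂
CharacteristicZero F = ∀ n → (suc n · 1#) # 0#
  where
  open HeytingField F using (1#; 0#; _#_)
  open Multiple F

module Tilings {c ℓ₁ ℓ₂ : Level} (F : HeytingField c ℓ₁ ℓ₂)
               (π : HeytingField.Carrier F) where
  open HeytingField F using (Carrier; _≈_; _+_)
  open Multiple F public

  -- The angles of a pentagon, in cyclic order.
  Pentagon : Set c
  Pentagon = Fin 5 → Carrier

  Assignment : Set c
  Assignment = Tile → Pentagon

  -- f is a correspondence of edges: the adjacent edges k and next k are sent
  -- to adjacent edges, in the same or the opposite order, and the angle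
  -- between them is preserved.
  AngleCongruent : Pentagon → Pentagon → Set ℓ₁
  AngleCongruent p q = Σ (Permutation′ 5) λ f → ∀ k →
    (f ⟨$⟩ʳ next k ≡ next (f ⟨$⟩ʳ k) × p k ≈ q (f ⟨$⟩ʳ k)) ⊎
    (f ⟨$⟩ʳ k ≡ next (f ⟨$⟩ʳ next k) × p k ≈ q (f ⟨$⟩ʳ next k))

  -- The angles of p, counted with multiplicity and in some order, are those
  -- of the list.
  HasAngles : Pentagon → Vec Carrier 5 → Set ℓ₁
  HasAngles p as = Σ (Permutation′ 5) λ f → ∀ k → p k ≈ lookup as (f ⟨$⟩ʳ k)

  record IsTiling (⟦_⟧ : Angle → Carrier) (A : Assignment) : Set ℓ₁ where
    field
      vertex    : ∀ i j l k m n → At i j l k → At j l i m → At l i j n →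
                  A i k + A j m + A l n ≈ 2 · π
      congruent : ∀ i j → AngleCongruent (A i) (A j)
      angles    : ∀ i → HasAngles (A i) (⟦ α ⟧ ∷ ⟦ α ⟧ ∷ ⟦ β ⟧ ∷ ⟦ γ ⟧ ∷ ⟦ δ ⟧ ∷ [])

  evaluate : (Angle → Carrier) → Labelling → Assignment
  evaluate ⟦_⟧ L i k = ⟦ L i k ⟧

  -- A is given by the labelling L, up to symmetries of the pattern and
  -- permutations of the names β, γ, δ.
  GivenUpToSymmetry : (Angle → Carrier) → Labelling → Assignment → Set ℓ₁
  GivenUpToSymmetry ⟦_⟧ L A =
    Σ Symmetry λ s → Σ Renaming λ r → ∀ i k →
      A i k ≈ ⟦ Renaming.rename r (L (Symmetry.σ s i) (Symmetry.corner s i k)) ⟧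

{-# OPTIONS --safe #-}
-- Every vertex meets three corners, so summing over the 60 corners gives
-- β + γ + δ = 2π; with distinct angles and characteristic zero, the only
-- possible vertices are then ααα and βγδ.  Two adjacent α in every tile are
-- incompatible with this, and if the two α are separated, then the α vertices
-- form one of the five cubes inscribed in the dodecahedron, on which the five
-- rotations about the axis through P₁ and P₁₂ act transitively.  The corners β
-- and γ of a tile lie along one edge, these six edges match the tiles in pairs,
-- and only the order of β and γ along each of them is left free.
module Submission where

open import Defs
open import Algebra.Apartness.Bundles using (HeytingField; HeytingCommutativeRing)
import Algebra.Apartness.Properties.HeytingCommutativeRing as HeytingProperties
open import Algebra.Bundles using (CommutativeMonoid; CommutativeRing)
import Algebra.Properties.CommutativeMonoid.Mult as CommutativeMonoidMult
import Algebra.Properties.CommutativeMonoid.Sum as CommutativeMonoidSum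
import Algebra.Properties.CommutativeSemigroup as CommutativeSemigroupProperties
import Algebra.Properties.Group as GroupProperties
import Algebra.Properties.Monoid.Mult as MonoidMult
import Algebra.Properties.Semiring.Mult as SemiringMult
open import Data.Bool.Base using (Bool; true; false; not; if_then_else_)
open import Data.Bool.Properties using () renaming (_≟_ to _≟ᵇ_)
open import Data.Fin.Base using (Fin; suc; toℕ; _↑ˡ_; _↑ʳ_; remQuot; combine)
open import Data.Fin.Patterns
open import Data.Fin.Permutation using (Permutation′; permutation; _⟨$⟩ʳ_)
open import Data.Fin.Properties
  using (_≟_; all?; any?; splitAt-↑ˡ; splitAt-↑ʳ; remQuot-combine)
open import Data.List.Base as List using (List; []; _∷_; allFin; concatMap; filter)
import Data.List.Membership.DecPropositional as DecMembership
open import Data.List.Membership.Propositional using (_∈_; find)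
open import Data.List.Membership.Propositional.Properties
  using (∈-allFin; ∈-concatMap⁺; ∈-filter⁺; ∈-map⁺)
open import Data.List.Relation.Unary.All as All using (All)
open import Data.List.Relation.Unary.All.Properties using ()
  renaming (map⁺ to All-map⁺; map⁻ to All-map⁻)
open import Data.List.Relation.Unary.Any as Any using (Any)
open import Data.Nat.Base as ℕ using (ℕ)
open import Data.Nat.DivMod using (_mod_)
open import Data.Nat.GeneralisedArithmetic using (fold)
open import Data.Product.Base as Product using (Σ; ∃; _×_; _,_; proj₁; proj₂; uncurry)
open import Data.Product.Properties using (≡-dec)
open import Data.Sum.Base as Sum using (_⊎_; inj₁; inj₂; [_,_]′)
open import Data.Vec.Base using (Vec; []; _∷_; lookup; tabulate)
open import Data.Vec.Properties using (lookup∘tabulate)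
open import Function.Base using (_∘_; id)
open import Function.Bundles using (Injection; mk↔ₛ′)
open import Function.Definitions using (Injective)
open import Function.Properties.Inverse using (↔⇒↣)
open import Level using (Level; 0ℓ)
open import Relation.Binary.Definitions using (DecidableEquality)
open import Relation.Binary.PropositionalEquality
  using (_≡_; _≢_; refl; sym; trans; cong; subst; subst₂)
import Relation.Binary.Reasoning.Setoid as SetoidReasoning
open import Relation.Nullary
  using (Dec; yes; no; contradiction; ¬?; _×-dec_; _⊎-dec_; _→-dec_)
open import Relation.Nullary.Decidable using (map′; toWitness)
open import Relation.Unary using (Pred; Decidable)

-- Decision procedures for finite checks.

code : Angle → Fin 4
code α = 0F
code β = 1F
code γ = 2F
code δ = 3F

decode : Fin 4 → Angle
decode = lookup (α ∷ β ∷ γ ∷ δ ∷ [])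

-- Through this retraction, angles inherit decidable equality from `Fin 4`, and `all?` decides
-- statements about all angles, as in `third`.
decode-code : ∀ x → decode (code x) ≡ x
decode-code α = refl
decode-code β = refl
decode-code γ = refl
decode-code δ = refl

infix 4 _≟ₐ_

_≟ₐ_ : DecidableEquality Angle
x ≟ₐ y = map′
  (λ eq → trans (sym (decode-code x)) (trans (cong decode eq) (decode-code y)))
  (cong code) (code x ≟ code y)

all-Bool? : ∀ {p} {P : Pred Bool p} → Decidable P → Dec (∀ b → P b)
all-Bool? P? = map′ (λ { (pt , pf) true → pt ; (pt , pf) false → pf })
  (λ f → f true , f false) (P? true ×-dec P? false)

all-BoolVec? : ∀ {p n} {P : Pred (Vec Bool n) p} → Decidable P → Dec (∀ v → P v)
all-BoolVec? {n = ℕ.zero}  P? = map′ (λ { p [] → p }) (λ f → f []) (P? [])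
all-BoolVec? {n = ℕ.suc n} P? = map′ (λ { f (b ∷ v) → f b v }) (λ f b v → f (b ∷ v))
  (all-Bool? λ b → all-BoolVec? λ v → P? (b ∷ v))

-- Angle words of a tile

infixl 6 _⊕_ _⊖_

-- Arithmetic modulo 5; the truncated subtraction is exact because `toℕ j < 5`.
_⊕_ _⊖_ : Fin 5 → Fin 5 → Fin 5
i ⊕ j = (toℕ i ℕ.+ toℕ j) mod 5
i ⊖ j = (toℕ i ℕ.+ (5 ℕ.∸ toℕ j)) mod 5

swapIf : Bool → Angle → Angle
swapIf b x = if b then swapβγ x else x

-- The words are arranged so that the reflection fixing corner 0 amounts to the
-- exchange of β and γ.
data Kind : Set where
  separated adjacent : Kind

word : Kind → Fin 5 → Angle
word separated = lookup (δ ∷ α ∷ β ∷ γ ∷ α ∷ [])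
word adjacent  = lookup (δ ∷ β ∷ α ∷ α ∷ γ ∷ [])

involution : (f : Angle → Angle) → f α ≡ α → (∀ x → f (f x) ≡ x) → Renaming
involution f f-α f-f = record { perm = mk↔ₛ′ f f f-f f-f ; fix-α = f-α }

swapβδ swapγδ : Angle → Angle
swapβδ α = α
swapβδ β = δ
swapβδ γ = γ
swapβδ δ = β
swapγδ α = α
swapγδ β = β
swapγδ γ = δ
swapγδ δ = γ

-- One involution for each choice of the name in the place of `δ`; the order of the other two names
-- is left to the flip.
renamings : List Renaming
renamings =
    involution id refl (λ _ → refl)
  ∷ involution swapβδ refl (λ { α → refl ; β → refl ; γ → refl ; δ → refl })
  ∷ involution swapγδ refl (λ { α → refl ; β → refl ; γ → refl ; δ → refl })
  ∷ []

-- The position is that of the angle in the place of δ, which the naming takes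
-- to δ; the flip is the order of the other two.
record Form : Set where
  constructor form
  field
    kind     : Kind
    naming   : Renaming
    flip     : Bool
    position : Fin 5

open Renaming using (rename; fix-α; perm)

read : Form → Fin 5 → Angle
read (form κ r b d) k = rename r (swapIf b (word κ (k ⊖ d)))

forms : List Form
forms = concatMap (λ κ → concatMap (λ r → concatMap (λ b → List.map (form κ r b)
  (allFin 5)) (true ∷ false ∷ [])) renamings) (separated ∷ adjacent ∷ [])

names : Fin 5 → Angle
names = lookup (α ∷ α ∷ β ∷ γ ∷ δ ∷ [])

-- The inequalities are interleaved with the quantifiers, so that the decision procedure abandons a
-- repeated value at once and evaluates `P?` only at the 120 injective words.
Arrangements : Pred (Vec (Fin 5) 5) 0ℓ → Set
Arrangements P = ∀ a b → a ≢ b → ∀ c → a ≢ c → b ≢ c → ∀ d → a ≢ d → b ≢ d → c ≢ d →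
  ∀ e → a ≢ e → b ≢ e → c ≢ e → d ≢ e → P (a ∷ b ∷ c ∷ d ∷ e ∷ [])

arrangements? : ∀ {P} → Decidable P → Dec (Arrangements P)
arrangements? P? =
  all? λ a → all? λ b → ¬? (a ≟ b) →-dec
  all? λ c → ¬? (a ≟ c) →-dec ¬? (b ≟ c) →-dec
  all? λ d → ¬? (a ≟ d) →-dec ¬? (b ≟ d) →-dec ¬? (c ≟ d) →-dec
  all? λ e → ¬? (a ≟ e) →-dec ¬? (b ≟ e) →-dec ¬? (c ≟ e) →-dec ¬? (d ≟ e) →-dec
  P? (a ∷ b ∷ c ∷ d ∷ e ∷ [])

arrangement : ∀ P → Arrangements P → (π : Permutation′ 5) → P (tabulate (π ⟨$⟩ʳ_))
arrangement P all π =
  all _ _ (≢ 0F 1F λ ()) _ (≢ 0F 2F λ ()) (≢ 1F 2F λ ())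
    _ (≢ 0F 3F λ ()) (≢ 1F 3F λ ()) (≢ 2F 3F λ ())
    _ (≢ 0F 4F λ ()) (≢ 1F 4F λ ()) (≢ 2F 4F λ ()) (≢ 3F 4F λ ())
  where
  ≢ : ∀ i j → i ≢ j → π ⟨$⟩ʳ i ≢ π ⟨$⟩ʳ j
  ≢ i j i≢j eq = i≢j (Injection.injective (↔⇒↣ π) eq)

-- With two equal letters `α` there are 5!/2 = 60 words, one for each member of `forms`.
arrangement-form : (π : Permutation′ 5) → ∃ λ φ → ∀ k → names (π ⟨$⟩ʳ k) ≡ read φ k
arrangement-form π = Any.satisfied (Any.map
  (λ {φ} eq k → trans (cong names (sym (lookup∘tabulate (π ⟨$⟩ʳ_) k))) (eq k))
  (arrangement HasForm forms-complete π))
  where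
  HasForm : Pred (Vec (Fin 5) 5) 0ℓ
  HasForm v = Any (λ φ → ∀ k → names (lookup v k) ≡ read φ k) forms

  forms-complete : Arrangements HasForm
  forms-complete = toWitness { a? = arrangements? λ v →
    Any.any? (λ φ → all? λ k → names (lookup v k) ≟ₐ read φ k) forms } _

Adjacent : Fin 5 → Fin 5 → Set
Adjacent i j = j ≡ next i ⊎ i ≡ next j

dihedral : (π : Permutation′ 5) → (∀ k → Adjacent (π ⟨$⟩ʳ k) (π ⟨$⟩ʳ next k)) →
  (∃ λ c → ∀ k → π ⟨$⟩ʳ k ≡ c ⊕ k) ⊎ (∃ λ c → ∀ k → π ⟨$⟩ʳ k ≡ c ⊖ k)
dihedral π adj = [ (λ { (c , eq) → inj₁ (c , λ k → trans (sym (at k)) (eq k)) })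
                 , (λ { (c , eq) → inj₂ (c , λ k → trans (sym (at k)) (eq k)) }) ]′
  (arrangement IsDihedral check π λ k → subst₂ Adjacent (sym (at k)) (sym (at (next k))) (adj k))
  where
  at : ∀ k → lookup (tabulate (π ⟨$⟩ʳ_)) k ≡ π ⟨$⟩ʳ k
  at = lookup∘tabulate (π ⟨$⟩ʳ_)

  IsDihedral : Pred (Vec (Fin 5) 5) 0ℓ
  IsDihedral v = (∀ k → Adjacent (lookup v k) (lookup v (next k))) →
    (∃ λ c → ∀ k → lookup v k ≡ c ⊕ k) ⊎ (∃ λ c → ∀ k → lookup v k ≡ c ⊖ k)

  check : Arrangements IsDihedral
  check = toWitness { a? = arrangements? λ v →
    (all? λ k → (lookup v (next k) ≟ next (lookup v k)) ⊎-dec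
                (lookup v k ≟ next (lookup v (next k)))) →-dec
    ((any? λ c → all? λ k → lookup v k ≟ c ⊕ k) ⊎-dec
     (any? λ c → all? λ k → lookup v k ≟ c ⊖ k)) } _

CongruentWords : (u v : Fin 5 → Angle) → Set
CongruentWords u v = Σ (Permutation′ 5) λ f → ∀ k →
  (f ⟨$⟩ʳ next k ≡ next (f ⟨$⟩ʳ k) × u k ≡ v (f ⟨$⟩ʳ k)) ⊎
  (f ⟨$⟩ʳ k ≡ next (f ⟨$⟩ʳ next k) × u k ≡ v (f ⟨$⟩ʳ next k))

swapβγ-involutive : ∀ x → swapβγ (swapβγ x) ≡ x
swapβγ-involutive α = refl
swapβγ-involutive β = refl
swapβγ-involutive γ = refl
swapβγ-involutive δ = refl

swapIf-not : ∀ b x → swapIf b (swapβγ x) ≡ swapIf (not b) x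
swapIf-not true  α = refl
swapIf-not true  β = refl
swapIf-not true  γ = refl
swapIf-not true  δ = refl
swapIf-not false x = refl

-- Corner `k` lies between edges `k` and `next k`, so the edge reflection `c ⊖_` takes it to corner
-- `c ⊖ next k`. Measured from the position of `δ`, this is negation modulo 5, which exchanges `β`
-- and `γ` in both words.
word-reflect : ∀ κ c d k → word κ ((c ⊖ next k) ⊖ d) ≡ swapβγ (word κ (k ⊖ ((c ⊖ d) ⊖ 1F)))
word-reflect separated = toWitness { a? = all? λ c → all? λ d → all? λ k → _ ≟ₐ _ } _
word-reflect adjacent  = toWitness { a? = all? λ c → all? λ d → all? λ k → _ ≟ₐ _ } _

-- A rotation moves the position of `δ`, and a reflection also reverses the flip. The kind and the
-- naming are therefore common to all tiles of a tiling.
congruent-form : ∀ {u v} → CongruentWords u v → ∀ κ r b d → (∀ k → v k ≡ read (form κ r b d) k) →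
  ∃ λ b′ → ∃ λ d′ → ∀ k → u k ≡ read (form κ r b′ d′) k
congruent-form {u} {v} (f , cong-f) κ r b d v≗ =
  [ (λ { (c , f≗) → b , d ⊖ c , λ k →
      trans (preserving c f≗ k (cong-f k)) (trans (v≗ _)
        (cong (rename r ∘ swapIf b ∘ word κ) (⊕-⊖ c d k))) })
  , (λ { (c , f≗) → not b , (c ⊖ d) ⊖ 1F , λ k →
      trans (reversing c f≗ k (cong-f k)) (trans (v≗ _)
        (cong (rename r) (trans (cong (swapIf b) (word-reflect κ c d k)) (swapIf-not b _)))) })
  ]′ (dihedral f λ k → Sum.map proj₁ proj₁ (cong-f k))
  where
  ⊕-⊖ : ∀ c d k → (c ⊕ k) ⊖ d ≡ k ⊖ (d ⊖ c)
  ⊕-⊖ = toWitness { a? = all? λ c → all? λ d → all? λ k → _ ≟ _ } _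

  preserving : ∀ c → (∀ k → f ⟨$⟩ʳ k ≡ c ⊕ k) → ∀ k → _ → u k ≡ v (c ⊕ k)
  preserving c f≗ k (inj₁ (_ , eq)) = trans eq (cong v (f≗ k))
  -- A rotation reversing the order of adjacent edges would require 2 = 0 modulo 5.
  preserving c f≗ k (inj₂ (f-k , _)) = contradiction
    (trans (sym (f≗ k)) (trans f-k (cong next (f≗ (next k)))))
    (toWitness { a? = all? λ c → all? λ k → ¬? (c ⊕ k ≟ next (c ⊕ next k)) } _ c k)

  reversing : ∀ c → (∀ k → f ⟨$⟩ʳ k ≡ c ⊖ k) → ∀ k → _ → u k ≡ v (c ⊖ next k)
  reversing c f≗ k (inj₂ (_ , eq)) = trans eq (cong v (f≗ (next k)))
  reversing c f≗ k (inj₁ (f-k , _)) = contradiction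
    (trans (sym (f≗ (next k))) (trans f-k (cong next (f≗ k))))
    (toWitness { a? = all? λ c → all? λ k → ¬? (c ⊖ next k ≟ next (c ⊖ k)) } _ c k)

-- Vertices and the positions of the angle δ

-- Turning around the vertex at corner k of tile i, one meets corner  opp i k  of
-- tile  nbr i k  next.
opp : Tile → Fin 5 → Fin 5
opp i k = lookup (lookup table i) k
  where
  table : Vec (Vec (Fin 5) 5) 12
  table =
      (4F ∷ 4F ∷ 4F ∷ 4F ∷ 4F ∷ [])
    ∷ (4F ∷ 3F ∷ 1F ∷ 2F ∷ 0F ∷ [])
    ∷ (0F ∷ 3F ∷ 1F ∷ 2F ∷ 0F ∷ [])
    ∷ (1F ∷ 3F ∷ 1F ∷ 2F ∷ 0F ∷ [])
    ∷ (2F ∷ 3F ∷ 1F ∷ 2F ∷ 0F ∷ [])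
    ∷ (3F ∷ 3F ∷ 1F ∷ 2F ∷ 0F ∷ [])
    ∷ (4F ∷ 3F ∷ 1F ∷ 2F ∷ 0F ∷ [])
    ∷ (3F ∷ 3F ∷ 1F ∷ 2F ∷ 0F ∷ [])
    ∷ (2F ∷ 3F ∷ 1F ∷ 2F ∷ 0F ∷ [])
    ∷ (1F ∷ 3F ∷ 1F ∷ 2F ∷ 0F ∷ [])
    ∷ (0F ∷ 3F ∷ 1F ∷ 2F ∷ 0F ∷ [])
    ∷ (4F ∷ 4F ∷ 4F ∷ 4F ∷ 4F ∷ [])
    ∷ []

At? : ∀ i j l k → Dec (At i j l k)
At? i j l k = (nbr i k ≟ j) ×-dec (nbr i (next k) ≟ l)

Corner : Set
Corner = Tile × Fin 5

across : Corner → Corner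
across (i , k) = nbr i k , opp i k

At-across : ∀ i k → let j , m = across (i , k) ; l , n = across (j , m) in
  At i j l k × At j l i m × At l i j n
At-across = toWitness { a? = all? λ i → all? λ k →
  let j , m = across (i , k) ; l , n = across (j , m) in
  At? i j l k ×-dec At? j l i m ×-dec At? l i j n } _

-- Reduces the vertex condition of `IsTiling` to one triple of corners for each starting corner.
across-unique : ∀ {i j l k m} → At i j l k → At j l i m → (j , m) ≡ across (i , k)
across-unique {i} {k = k} {m} (refl , refl) at-m = cong (nbr i k ,_) (opp-unique i k m at-m)
  where
  opp-unique : ∀ i k m → At (nbr i k) (nbr i (next k)) i m → m ≡ opp i k
  opp-unique = toWitness { a? = all? λ i → all? λ k → all? λ m →
    At? (nbr i k) (nbr i (next k)) i m →-dec (m ≟ opp i k) } _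

-- A vertex has either three corners `α` or none. Namings and flips fix `α`, so only the kind and
-- the positions of `δ` enter.
Compatible : Kind → Corner → Corner → Set
Compatible κ (i , d) (j , e) = ∀ k → nbr i k ≡ j →
  (word κ (k ⊖ d) ≡ α → word κ (opp i k ⊖ e) ≡ α) ×
  (word κ (opp i k ⊖ e) ≡ α → word κ (k ⊖ d) ≡ α)

compatible? : ∀ κ p q → Dec (Compatible κ p q × Compatible κ q p)
compatible? κ p q = go p q ×-dec go q p
  where
  go : ∀ p q → Dec (Compatible κ p q)
  go (i , d) (j , e) = all? λ k → nbr i k ≟ j →-dec
    ((word κ (k ⊖ d) ≟ₐ α) →-dec (word κ (opp i k ⊖ e) ≟ₐ α)) ×-dec
    ((word κ (opp i k ⊖ e) ≟ₐ α) →-dec (word κ (k ⊖ d) ≟ₐ α))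

Fits : Kind → Tile → List Corner → Fin 5 → Set
Fits κ i ps d = All (λ q → Compatible κ (i , d) q × Compatible κ q (i , d)) ps

fits? : ∀ κ i ps → Decidable (Fits κ i ps)
fits? κ i ps d = All.all? (compatible? κ (i , d)) ps

-- Backtracking: the prefixes that already violate compatibility are dropped,
-- which keeps the evaluation of the complete list cheap.
placements : Kind → List Tile → List (List Corner)
placements κ []       = [] ∷ []
placements κ (i ∷ is) = concatMap
  (λ ps → List.map (λ d → (i , d) ∷ ps) (filter (fits? κ i ps) (allFin 5)))
  (placements κ is)

-- Compatibility is pairwise, hence inherited by every sublist of tiles, and no filter removes a
-- part of a global solution.
placements-complete : ∀ κ (d : Tile → Fin 5) →
  (∀ i j → Compatible κ (i , d i) (j , d j)) →
  ∀ is → List.map (λ i → i , d i) is ∈ placements κ is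
placements-complete κ d ok []       = Any.here refl
placements-complete κ d ok (i ∷ is) = ∈-concatMap⁺ _
  (Any.map (λ { refl → ∈-map⁺ (λ e → (i , e) ∷ _)
      (∈-filter⁺ (fits? κ i (List.map (λ j → j , d j) is)) (∈-allFin (d i)) fits) })
    (placements-complete κ d ok is))
  where
  fits : Fits κ i (List.map (λ j → j , d j) is) (d i)
  fits = All-map⁺ (All.tabulate λ {j} _ → ok i j , ok j i)

turnBy : ℕ → Tile → Tile
turnBy n i = fold i (lookup step) n
  where
  step : Vec Tile 12
  step = P₁ ∷ P₃ ∷ P₄ ∷ P₅ ∷ P₆ ∷ P₂ ∷ P₈ ∷ P₉ ∷ P₁₀ ∷ P₁₁ ∷ P₇ ∷ P₁₂ ∷ []

-- Rotations about the axis through P₁ and P₁₂.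
turn turn⁻¹ : Fin 5 → Tile → Tile
turn   a = turnBy (toℕ a)
turn⁻¹ a = turnBy (5 ℕ.∸ toℕ a)

-- The two tiles on the axis are turned in opposite senses of their lists. Every other list begins
-- with a tile on the axis, so these lists correspond entry by entry.
turnCorner : Fin 5 → Tile → Fin 5 → Fin 5
turnCorner a P₁  k = k ⊕ a
turnCorner a P₁₂ k = k ⊖ a
turnCorner a _   k = k

rotation : Fin 5 → Symmetry
rotation a = record
  { tile     = permutation (turn a) (turn⁻¹ a)
      (toWitness { a? = all? λ a → all? λ i → turn a (turn⁻¹ a i) ≟ i } _ a)
      (toWitness { a? = all? λ a → all? λ i → turn⁻¹ a (turn a i) ≟ i } _ a)
  ; corner   = turnCorner a
  ; preserve = λ i k → inj₁ (toWitness { a? = all? λ a → all? λ i → all? λ k →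
      At? (turn a i) (turn a (nbr i k)) (turn a (nbr i (next k))) (turnCorner a i k) } _ a i k)
  }

δ-position : Tile → Fin 5
δ-position = lookup (0F ∷ 1F ∷ 3F ∷ 4F ∷ 2F ∷ 0F ∷ 2F ∷ 4F ∷ 3F ∷ 1F ∷ 0F ∷ 2F ∷ [])

base-word : ∀ i k → base i k ≡ word separated (k ⊖ δ-position i)
base-word = toWitness
  { a? = all? λ i → all? λ k → base i k ≟ₐ word separated (k ⊖ δ-position i) } _

-- By hand: if the `α` of a tile lie along an edge, so do those of the tile across it. The third
-- tile at an end of this edge then has its second `α` at a further vertex of one of the two tiles,
-- giving that tile a third `α`.
adjacent-placements : placements adjacent (allFin 12) ≡ []
adjacent-placements = refl

separated-placements : All
  (λ ps → ∃ λ a → All (λ (i , d) → turnCorner a i d ≡ δ-position (turn a i)) ps)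
  (placements separated (allFin 12))
separated-placements = toWitness { a? = All.all? (λ ps → any? λ a →
  All.all? (λ (i , d) → turnCorner a i d ≟ δ-position (turn a i)) ps) _ } _

-- Every tile has exactly one of the six exchange edges on its boundary.
edgeOf : Tile → Fin 6
edgeOf = lookup (0F ∷ 1F ∷ 1F ∷ 2F ∷ 0F ∷ 3F ∷ 4F ∷ 2F ∷ 5F ∷ 5F ∷ 3F ∷ 4F ∷ [])

-- The corners of a tile at the ends of its exchange edge are its `β` and `γ`, so an exchange acts
-- on the whole word of the tile.
exchanged-base : ∀ S i k → exchanged S i k ≡ swapIf (lookup S (edgeOf i)) (base i k)
exchanged-base = toWitness { a? = all-BoolVec? λ S → all? λ i → all? λ k →
  exchanged S i k ≟ₐ swapIf (lookup S (edgeOf i)) (base i k) } _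

-- What is used of the angles at two corners of a vertex ααα or βγδ.
Good : Angle → Angle → Set
Good x y = (x ≡ α → y ≡ α) × (y ≡ α → x ≡ α) × (x ≡ y → x ≡ α)

swapIf-α : ∀ b x → swapIf b x ≡ α → x ≡ α
swapIf-α true  α eq = refl
swapIf-α false α eq = refl
swapIf-α false β ()
swapIf-α true δ ()

α-name : ∀ r b {x} → x ≡ α → rename r (swapIf b x) ≡ α
α-name r true  refl = fix-α r
α-name r false refl = fix-α r

rename-injective : ∀ r {x y} → rename r x ≡ rename r y → x ≡ y
rename-injective r = Injection.injective (↔⇒↣ (perm r))

name-α : ∀ r b {x} → rename r (swapIf b x) ≡ α → x ≡ α
name-α r b eq = swapIf-α b _ (rename-injective r (trans eq (sym (fix-α r))))

-- Tiles i and j have corners β and γ, or γ and β, at a common vertex, so that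
-- exchanging β and γ in only one of them would put two equal angles there.
Linked : Fin 5 → Tile → Tile → Set
Linked a i j = i ≡ j ⊎ ∃ λ k → nbr i k ≡ j × x k ≢ swapβγ (x k) ×
  base (turn a j) (turnCorner a j (opp i k)) ≡ swapβγ (x k)
  where
  x : Fin 5 → Angle
  x k = base (turn a i) (turnCorner a i k)

-- The first tile along an exchange edge, pulled back by the rotation, represents its pair: its flip
-- decides whether the edge is selected.
partner : Fin 5 → Fin 6 → Tile
partner a e = turn⁻¹ a (proj₁ (lookup exchangeEdges e))

linked : ∀ a i → Linked a i (partner a (edgeOf (turn a i)))
linked = toWitness { a? = all? λ a → all? λ i → (i ≟ _) ⊎-dec any? λ k →
  (nbr i k ≟ _) ×-dec ¬? (_ ≟ₐ _) ×-dec (_ ≟ₐ _) } _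

turnCorner-⊖ : ∀ a i k d → turnCorner a i k ⊖ turnCorner a i d ≡ k ⊖ d
turnCorner-⊖ = toWitness { a? = all? λ a → all? λ i → all? λ k → all? λ d → _ ≟ _ } _

-- Labellings with good vertices.

module _ {L : Labelling} (good : ∀ i k → Good (L i k) (L (nbr i k) (opp i k)))
  (κ : Kind) (r : Renaming) (b : Tile → Bool) (d : Tile → Fin 5)
  (L≗ : ∀ i k → L i k ≡ read (form κ r (b i) (d i)) k) where

  compatible : ∀ i j → Compatible κ (i , d i) (j , d j)
  compatible i j k refl with good i k
  ... | ⇒ , ⇐ , _ =
    (λ eq → name-α r _ (trans (sym (L≗ _ _)) (⇒ (trans (L≗ i k) (α-name r (b i) eq))))) ,
    (λ eq → name-α r _ (trans (sym (L≗ i k)) (⇐ (trans (L≗ _ _) (α-name r (b _) eq)))))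

  placement : List.map (λ i → i , d i) (allFin 12) ∈ placements κ (allFin 12)
  placement = placements-complete κ d compatible (allFin 12)

  separated-labelling : κ ≡ separated → ∀ a →
    (∀ i → turnCorner a i (d i) ≡ δ-position (turn a i)) → ∃ λ S → Σ Symmetry λ s → ∀ i k →
    L i k ≡ rename r (exchanged S (Symmetry.σ s i) (Symmetry.corner s i k))
  separated-labelling refl a placed = S , rotation a , λ i k →
    trans (labelled i k) (cong (rename r) (sym (trans (exchanged-base S (turn a i) (turnCorner a i k))
      (cong (λ b → swapIf b (base (turn a i) (turnCorner a i k)))
        (trans (lookup∘tabulate (b ∘ partner a) (edgeOf (turn a i))) (sym (flips i _ (linked a i))))))))
    where
    S : Vec Bool 6
    S = tabulate (b ∘ partner a)

    labelled : ∀ i k → L i k ≡ rename r (swapIf (b i) (base (turn a i) (turnCorner a i k)))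
    labelled i k = trans (L≗ i k) (cong (rename r ∘ swapIf (b i)) (sym
      (trans (base-word (turn a i) (turnCorner a i k)) (cong (word separated)
        (trans (cong (turnCorner a i k ⊖_) (sym (placed i)))
          (turnCorner-⊖ a i k (d i)))))))

    swapIf-swap : ∀ b b′ x → x ≢ swapβγ x → b ≡ b′ ⊎ swapIf b x ≡ swapIf b′ (swapβγ x)
    swapIf-swap true  true  x x≢ = inj₁ refl
    swapIf-swap false false x x≢ = inj₁ refl
    swapIf-swap false true  x x≢ = inj₂ (sym (swapβγ-involutive x))
    swapIf-swap true  false x x≢ = inj₂ refl

    flips : ∀ i j → Linked a i j → b i ≡ b j
    flips i .i (inj₁ refl) = refl
    flips i _ (inj₂ (k , refl , x≢ , y≡)) with swapIf-swap (b i) (b (nbr i k)) _ x≢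
    ... | inj₁ eq = eq
    -- Different flips would put equal names at two corners of a vertex, which `good` allows only
    -- for `α`, whereas `x≢` makes the corner a `β` or `γ`.
    ... | inj₂ eq = contradiction (name-α r (b i) (trans (sym (labelled i k)) (proj₂ (proj₂ (good i k))
      (trans (labelled i k) (trans (cong (rename r) (trans eq (cong (swapIf (b (nbr i k))) (sym y≡))))
        (sym (labelled (nbr i k) (opp i k)))))))) (λ x≡α → x≢ (trans x≡α (cong swapβγ (sym x≡α))))

  is-separated : κ ≡ separated
  is-separated = no-adjacent κ placement
    where
    no-adjacent : ∀ κ {ps} → ps ∈ placements κ (allFin 12) → κ ≡ separated
    no-adjacent separated _ = refl
    no-adjacent adjacent {ps} p with () ← subst (ps ∈_) adjacent-placements p

  placed : ∃ λ a → ∀ i → turnCorner a i (d i) ≡ δ-position (turn a i)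
  placed = Product.map₂ (λ all i → All.lookup (All-map⁻ {f = λ i → i , d i} all) (∈-allFin i))
    (All.lookup separated-placements
      (subst (λ κ → List.map (λ i → i , d i) (allFin 12) ∈ placements κ (allFin 12)) is-separated placement))

  labelling : ∃ λ S → Σ Symmetry λ s → ∀ i k →
    L i k ≡ rename r (exchanged S (Symmetry.σ s i) (Symmetry.corner s i k))
  labelling = separated-labelling is-separated (proj₁ placed) (proj₂ placed)

-- The exchanged labellings

-- All orders of `β`, `γ`, `δ` are listed, since a vertex may be read from any corner and an
-- exchange can reverse its cyclic order.
balanced : List (Angle × Angle × Angle)
balanced = (α , α , α)
  ∷ (β , γ , δ) ∷ (γ , δ , β) ∷ (δ , β , γ)
  ∷ (γ , β , δ) ∷ (β , δ , γ) ∷ (δ , γ , β) ∷ []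

open DecMembership (≡-dec _≟ₐ_ (≡-dec _≟ₐ_ _≟ₐ_)) using (_∈?_)

exchanged-vertex : ∀ S i k → let p = i , k in
  (uncurry (exchanged S) p , uncurry (exchanged S) (across p) , uncurry (exchanged S) (across (across p)))
    ∈ balanced
exchanged-vertex = toWitness { a? = all-BoolVec? λ S → all? λ i → all? λ k → _ ∈? balanced } _

exchanged-word : ∀ S i k →
  exchanged S i k ≡ swapIf (lookup S (edgeOf i)) (word separated (k ⊖ δ-position i))
exchanged-word S i k = trans (exchanged-base S i k) (cong (swapIf _) (base-word i k))

separated-arrangement : ∀ b d → Σ (Permutation′ 5) λ f → ∀ k →
  swapIf b (word separated (k ⊖ d)) ≡ names (f ⟨$⟩ʳ k)
separated-arrangement b d = permutation (λ k → lookup (order b) (k ⊖ d)) (λ k → lookup (order⁻¹ b) k ⊕ d)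
    (toWitness { a? = all-Bool? λ b → all? λ d → all? λ k →
      lookup (order b) ((lookup (order⁻¹ b) k ⊕ d) ⊖ d) ≟ k } _ b d)
    (toWitness { a? = all-Bool? λ b → all? λ d → all? λ k →
      lookup (order⁻¹ b) (lookup (order b) (k ⊖ d)) ⊕ d ≟ k } _ b d)
  , toWitness { a? = all-Bool? λ b → all? λ d → all? λ k →
      swapIf b (word separated (k ⊖ d)) ≟ₐ names (lookup (order b) (k ⊖ d)) } _ b d
  where
  order order⁻¹ : Bool → Vec (Fin 5) 5
  -- The indices in `names` of the letters `δ`, `α`, `β`, `γ`, `α`; a flip exchanges 2 and 3.
  order   b = 4F ∷ 0F ∷ (if b then 3F else 2F) ∷ (if b then 2F else 3F) ∷ 1F ∷ []
  order⁻¹ b = 1F ∷ 4F ∷ (if b then 3F else 2F) ∷ (if b then 2F else 3F) ∷ 0F ∷ []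

translate mirror : Fin 5 → Permutation′ 5
translate c = permutation (_⊕ c) (_⊖ c)
  (toWitness { a? = all? λ c → all? λ k → (k ⊖ c) ⊕ c ≟ k } _ c)
  (toWitness { a? = all? λ c → all? λ k → (k ⊕ c) ⊖ c ≟ k } _ c)
mirror c = permutation (c ⊖_) (c ⊖_) (c⊖c⊖ c) (c⊖c⊖ c)
  where
  c⊖c⊖ : ∀ c k → c ⊖ (c ⊖ k) ≡ k
  c⊖c⊖ = toWitness { a? = all? λ c → all? λ k → c ⊖ (c ⊖ k) ≟ k } _

separated-congruent : ∀ b d b′ d′ → CongruentWords
  (λ k → swapIf b (word separated (k ⊖ d))) (λ k → swapIf b′ (word separated (k ⊖ d′)))
separated-congruent b d b′ d′ with b ≟ᵇ b′
... | yes refl = translate (d′ ⊖ d) , λ k → inj₁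
  ( toWitness { a? = all? λ c → all? λ k → next k ⊕ c ≟ next (k ⊕ c) } _ (d′ ⊖ d) k
  , cong (swapIf b ∘ word separated) (toWitness { a? = all? λ d → all? λ d′ → all? λ k →
      k ⊖ d ≟ (k ⊕ (d′ ⊖ d)) ⊖ d′ } _ d d′ k) )
-- Corner `k` goes to `c ⊖ next k`; the extra `next` in the constant thus makes corner `d` go to
-- corner `d′`.
... | no b≢b′ = mirror (next (d ⊕ d′)) , λ k → inj₂
  ( toWitness { a? = all? λ c → all? λ k → c ⊖ k ≟ next (c ⊖ next k) } _ (next (d ⊕ d′)) k
  , mirrored b b′ b≢b′ _ _ (word-mirror d d′ k) )
  where
  word-mirror : ∀ d d′ k → word separated ((next (d ⊕ d′) ⊖ next k) ⊖ d′) ≡ swapβγ (word separated (k ⊖ d))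
  word-mirror = toWitness { a? = all? λ d → all? λ d′ → all? λ k → _ ≟ₐ _ } _

  mirrored : ∀ b b′ → b ≢ b′ → ∀ x y → y ≡ swapβγ x → swapIf b x ≡ swapIf b′ y
  mirrored true  true  b≢b′ x y eq   = contradiction refl b≢b′
  mirrored true  false b≢b′ x _ refl = refl
  mirrored false true  b≢b′ x _ refl = sym (swapβγ-involutive x)
  mirrored false false b≢b′ x y eq   = contradiction refl b≢b′

exchanged-congruent : ∀ S i j → CongruentWords (exchanged S i) (exchanged S j)
exchanged-congruent S i j = Product.map₂
  (λ eq k → Sum.map (Product.map₂ (words k _)) (Product.map₂ (words k _)) (eq k))
  (separated-congruent (lookup S (edgeOf i)) (δ-position i) (lookup S (edgeOf j)) (δ-position j))
  where
  words : ∀ k m → swapIf (lookup S (edgeOf i)) (word separated (k ⊖ δ-position i)) ≡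
                  swapIf (lookup S (edgeOf j)) (word separated (m ⊖ δ-position j)) →
          exchanged S i k ≡ exchanged S j m
  words k m eq = trans (exchanged-word S i k) (trans eq (sym (exchanged-word S j m)))

exchanged-arrangement : ∀ S i → Σ (Permutation′ 5) λ f → ∀ k → exchanged S i k ≡ names (f ⟨$⟩ʳ k)
exchanged-arrangement S i = Product.map₂ (λ eq k → trans (exchanged-word S i k) (eq k))
  (separated-arrangement (lookup S (edgeOf i)) (δ-position i))

Completes : Angle → Angle → Angle × Angle × Angle → Set
Completes x y (x′ , y′ , z) = x′ ≡ x × y′ ≡ y × z ≢ α × z ≢ x

-- The third angle is the remaining name; its two inequalities give the contradictions in `beside-α`
-- and `repeated`.
third : ∀ x y → x ≢ α → y ≢ α → x ≢ y → Any (Completes x y) balanced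
third x y x≢α y≢α x≢y = subst₂ (λ x y → Any (Completes x y) balanced)
  (decode-code x) (decode-code y) (by-code (code x) (code y)
    (x≢α ∘ trans (sym (decode-code x))) (y≢α ∘ trans (sym (decode-code y)))
    (λ eq → x≢y (trans (sym (decode-code x)) (trans eq (decode-code y)))))
  where
  by-code : ∀ c d → decode c ≢ α → decode d ≢ α → decode c ≢ decode d →
    Any (Completes (decode c) (decode d)) balanced
  by-code = toWitness { a? = all? λ c → all? λ d →
    ¬? (_ ≟ₐ _) →-dec ¬? (_ ≟ₐ _) →-dec ¬? (_ ≟ₐ _) →-dec
    Any.any? (λ _ → (_ ≟ₐ _) ×-dec (_ ≟ₐ _) ×-dec ¬? (_ ≟ₐ _) ×-dec ¬? (_ ≟ₐ _)) balanced } _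

-- Sums of angles

module _ {c ℓ} (M : CommutativeMonoid c ℓ) where
  open CommutativeMonoid M using (Carrier; _≈_; _∙_; ∙-congˡ; ∙-cong; identityˡ; assoc; reflexive)
    renaming (refl to ≈-refl; sym to ≈-sym; trans to ≈-trans)
  open CommutativeMonoidSum M

  ∑-++ : ∀ m {n} (f : Fin (m ℕ.+ n) → Carrier) →
    ∑[ i < m ℕ.+ n ] f i ≈ (∑[ i < m ] f (i ↑ˡ n)) ∙ (∑[ i < n ] f (m ↑ʳ i))
  ∑-++ ℕ.zero    f = ≈-sym (identityˡ _)
  ∑-++ (ℕ.suc m) f = ≈-trans (∙-congˡ (∑-++ m (f ∘ suc))) (≈-sym (assoc _ _ _))

  -- Flattening the double sum lets the turn around vertices, which moves corners between tiles, act
  -- as a reindexing.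
  ∑-remQuot : ∀ m n (f : Fin m → Fin n → Carrier) →
    ∑[ c < m ℕ.* n ] uncurry f (remQuot n c) ≈ ∑[ i < m ] ∑[ j < n ] f i j
  ∑-remQuot ℕ.zero    n f = ≈-refl
  ∑-remQuot (ℕ.suc m) n f = ≈-trans (∑-++ n _) (∙-cong
    (sum-cong-≋ λ j → reflexive (cong (uncurry f) (remQuot-↑ˡ j)))
    (≈-trans (sum-cong-≋ λ c → reflexive (cong (uncurry f) (remQuot-↑ʳ c))) (∑-remQuot m n (f ∘ suc))))
    where
    remQuot-↑ˡ : ∀ j → remQuot {ℕ.suc m} n (j ↑ˡ m ℕ.* n) ≡ (0F , j)
    remQuot-↑ˡ j rewrite splitAt-↑ˡ n j (m ℕ.* n) = refl
    remQuot-↑ʳ : ∀ c → remQuot {ℕ.suc m} n (n ↑ʳ c) ≡ Product.map₁ suc (remQuot n c)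
    remQuot-↑ʳ c rewrite splitAt-↑ʳ n (m ℕ.* n) c = refl

-- The turn around a vertex on corners numbered by  remQuot, for reindexing sums.
around : Fin 60 → Fin 60
around c = uncurry combine (across (remQuot {12} 5 c))

around-permutation : Permutation′ 60
around-permutation = permutation around (around ∘ around) around³ around³
  where
  around³ : ∀ c → around (around (around c)) ≡ c
  around³ = toWitness { a? = all? λ c → around (around (around c)) ≟ c } _

module Angles {c ℓ₁ ℓ₂ : Level} (F : HeytingField c ℓ₁ ℓ₂) (char0 : CharacteristicZero F)
  (π : HeytingField.Carrier F) (⟦_⟧ : Angle → HeytingField.Carrier F)
  (3α : HeytingField._≈_ F (Multiple._·_ F 3 ⟦ α ⟧) (Multiple._·_ F 2 π))
  (⟦⟧-injective : Injective _≡_ (HeytingField._≈_ F) ⟦_⟧) where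
  open HeytingField F hiding (refl; sym; trans)
  open HeytingField F using () renaming (refl to ≈-refl; sym to ≈-sym; trans to ≈-trans)
  open Tilings F π
  open CommutativeRing (HeytingCommutativeRing.commutativeRing heytingCommutativeRing)
    using (+-commutativeMonoid; +-commutativeSemigroup; +-group; +-monoid; semiring)
  open CommutativeMonoidSum +-commutativeMonoid
  open MonoidMult +-monoid using (×-congʳ; ×-homo-+; ×-assocˡ)
  open CommutativeMonoidMult +-commutativeMonoid using (×-distrib-+)
  open SemiringMult semiring using (×-assoc-*)
  open CommutativeSemigroupProperties +-commutativeSemigroup using (xy∙z≈xz∙y; xy∙z≈yz∙x)
  open GroupProperties +-group using ()
    renaming (∙-cancelˡ to +-cancelˡ; ∙-cancelʳ to +-cancelʳ)
  open HeytingProperties heytingCommutativeRing using (x-0≈x)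
  open SetoidReasoning setoid

  -- Characteristic zero makes `suc n · 1#` invertible.
  ·-cancel : ∀ n {x y} → ℕ.suc n · x ≈ ℕ.suc n · y → x ≈ y
  ·-cancel n {x} {y} eq with #⇒invertible (char0 n)
  ... | v , v*N≈1 , _ = ≈-trans (retract x) (≈-trans (*-congˡ eq) (≈-sym (retract y)))
    where
    N : Carrier
    N = ℕ.suc n · 1#

    retract : ∀ z → z ≈ v * (ℕ.suc n · z)
    retract z = begin
      z                         ≈⟨ *-identityˡ z ⟨
      1# * z                    ≈⟨ *-congʳ v*N≈1 ⟨
      (v * (N - 0#)) * z        ≈⟨ *-congʳ (*-congˡ (x-0≈x N)) ⟩
      (v * N) * z               ≈⟨ *-assoc v N z ⟩
      v * (N * z)               ≈⟨ *-congˡ (×-assoc-* (ℕ.suc n) 1# z) ⟩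
      v * (ℕ.suc n · (1# * z))  ≈⟨ *-congˡ (×-congʳ (ℕ.suc n) (*-identityˡ z)) ⟩
      v * (ℕ.suc n · z)         ∎

  total : Carrier
  total = ⟦ α ⟧ + (⟦ α ⟧ + (⟦ β ⟧ + (⟦ γ ⟧ + (⟦ δ ⟧ + 0#))))

  names-lookup : ∀ j → ⟦ names j ⟧ ≈ lookup (⟦ α ⟧ ∷ ⟦ α ⟧ ∷ ⟦ β ⟧ ∷ ⟦ γ ⟧ ∷ ⟦ δ ⟧ ∷ []) j
  names-lookup 0F = ≈-refl
  names-lookup 1F = ≈-refl
  names-lookup 2F = ≈-refl
  names-lookup 3F = ≈-refl
  names-lookup 4F = ≈-refl

  ⟦⟧-cong : ∀ {x y} → x ≡ y → ⟦ x ⟧ ≈ ⟦ y ⟧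
  ⟦⟧-cong eq = reflexive (cong ⟦_⟧ eq)

  -- Summing the vertex equation over all corners counts each corner three times:
  -- `60 · (2 · π) ≈ 36 · total`. By `3α`, 24 of the 60 full angles make up 36 times two `α`;
  -- cancelling 36 and then two `α` leaves the claim.
  angle-sum : ∀ A →
    (∀ p → uncurry A p + uncurry A (across p) + uncurry A (across (across p)) ≈ 2 · π) →
    (∀ i → ∑[ k < 5 ] A i k ≈ total) → ⟦ β ⟧ + ⟦ γ ⟧ + ⟦ δ ⟧ ≈ 2 · π
  angle-sum A vertex tile = ≈-trans (+-assoc _ _ _) (≈-sym (≈-trans
    -- The argument 35 cancels the factor 36.
    (+-cancelˡ (⟦ α ⟧ + ⟦ α ⟧) _ _ (≈-trans (·-cancel 35 36-fold) (≈-sym (+-assoc _ _ _))))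
    (+-congˡ (+-congˡ (+-identityʳ _)))))
    where
    corner : Fin 60 → Carrier
    corner c = uncurry A (remQuot {12} 5 c)

    corners : ∑[ c < 60 ] corner c ≈ 12 · total
    corners = begin
      ∑[ c < 60 ] corner c            ≈⟨ ∑-remQuot +-commutativeMonoid 12 5 A ⟩
      ∑[ i < 12 ] ∑[ k < 5 ] A i k    ≈⟨ sum-cong-≋ tile ⟩
      ∑[ i < 12 ] total               ≈⟨ sum-replicate 12 ⟩
      12 · total                      ∎

    shifted : ∀ (f : Fin 60 → Carrier) → ∑[ c < 60 ] f (around c) ≈ ∑[ c < 60 ] f c
    shifted f = ≈-sym (sum-permute f around-permutation)

    remQuot-around : ∀ c → remQuot {12} 5 (around c) ≡ across (remQuot {12} 5 c)
    remQuot-around c = uncurry remQuot-combine (across (remQuot {12} 5 c))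

    corner-vertex : ∀ c → corner c + corner (around c) + corner (around (around c)) ≈ 2 · π
    corner-vertex c = ≈-trans
      (+-cong (+-congˡ (reflexive (cong (uncurry A) (remQuot-around c))))
        (reflexive (cong (uncurry A) (trans (remQuot-around (around c)) (cong across (remQuot-around c))))))
      (vertex (remQuot {12} 5 c))

    doubled : 24 · (2 · π) ≈ 36 · (⟦ α ⟧ + ⟦ α ⟧)
    doubled = begin
      24 · (2 · π)       ≈⟨ ×-congʳ 24 3α ⟨
      24 · (3 · ⟦ α ⟧)   ≈⟨ ×-assocˡ ⟦ α ⟧ 24 3 ⟩
      72 · ⟦ α ⟧         ≈⟨ ×-assocˡ ⟦ α ⟧ 36 2 ⟨
      36 · (2 · ⟦ α ⟧)   ≈⟨ ×-congʳ 36 (+-congˡ (+-identityʳ _)) ⟩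
      36 · (⟦ α ⟧ + ⟦ α ⟧) ∎

    36-fold : 36 · ((⟦ α ⟧ + ⟦ α ⟧) + 2 · π) ≈ 36 · total
    36-fold = begin
      36 · ((⟦ α ⟧ + ⟦ α ⟧) + 2 · π)           ≈⟨ ×-distrib-+ _ _ 36 ⟩
      36 · (⟦ α ⟧ + ⟦ α ⟧) + 36 · (2 · π)      ≈⟨ +-congʳ doubled ⟨
      24 · (2 · π) + 36 · (2 · π)              ≈⟨ ×-homo-+ (2 · π) 24 36 ⟨
      60 · (2 · π)                             ≈⟨ sum-replicate 60 ⟨
      ∑[ c < 60 ] (2 · π)                      ≈⟨ sum-cong-≋ corner-vertex ⟨
      ∑[ c < 60 ] (corner c + corner (around c) + corner (around (around c)))
        ≈⟨ ∑-distrib-+ (λ c → corner c + corner (around c)) (corner ∘ around ∘ around) ⟩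
      ∑[ c < 60 ] (corner c + corner (around c)) + ∑[ c < 60 ] corner (around (around c))
        ≈⟨ +-cong (∑-distrib-+ corner (corner ∘ around)) (shifted (corner ∘ around)) ⟩
      ∑[ c < 60 ] corner c + ∑[ c < 60 ] corner (around c) + ∑[ c < 60 ] corner (around c)
        ≈⟨ +-cong (+-congˡ (shifted corner)) (shifted corner) ⟩
      ∑[ c < 60 ] corner c + ∑[ c < 60 ] corner c + ∑[ c < 60 ] corner c
        ≈⟨ +-cong (+-cong corners corners) corners ⟩
      12 · total + 12 · total + 12 · total     ≈⟨ +-congʳ (×-homo-+ total 12 12) ⟨
      24 · total + 12 · total                  ≈⟨ ×-homo-+ total 24 12 ⟨
      36 · total                               ∎

  -- Angles that can meet at a vertex.

  module _ (βγδ : ⟦ β ⟧ + ⟦ γ ⟧ + ⟦ δ ⟧ ≈ 2 · π) where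

    ααα : ⟦ α ⟧ + ⟦ α ⟧ + ⟦ α ⟧ ≈ 2 · π
    ααα = ≈-trans (+-assoc _ _ _) (≈-trans (+-congˡ (+-congˡ (≈-sym (+-identityʳ _)))) 3α)

    rotate : ∀ {x y z} → x + y + z ≈ 2 · π → y + z + x ≈ 2 · π
    rotate = ≈-trans (≈-sym (xy∙z≈yz∙x _ _ _))

    transpose : ∀ {x y z} → x + y + z ≈ 2 · π → x + z + y ≈ 2 · π
    transpose = ≈-trans (xy∙z≈xz∙y _ _ _)

    balanced-sum : All (λ (x , y , z) → ⟦ x ⟧ + ⟦ y ⟧ + ⟦ z ⟧ ≈ 2 · π) balanced
    balanced-sum = ααα All.∷ βγδ All.∷ rotate βγδ All.∷ rotate (rotate βγδ)
      All.∷ rotate (transpose (rotate (rotate βγδ))) All.∷ transpose βγδ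
      All.∷ transpose (rotate (rotate βγδ)) All.∷ All.[]

    third-sum : ∀ x y → x ≢ α → y ≢ α → x ≢ y →
      ∃ λ z → (z ≢ α × z ≢ x) × ⟦ x ⟧ + ⟦ y ⟧ + ⟦ z ⟧ ≈ 2 · π
    third-sum x y x≢α y≢α x≢y with find (third x y x≢α y≢α x≢y)
    ... | (_ , _ , z) , z∈ , refl , refl , z≢α , z≢x = z , (z≢α , z≢x) , All.lookup balanced-sum z∈

    -- Suppose `x` is not `α`. If `z` is `x` or `α`, cancelling a multiple gives equal values of `x`
    -- and `α`. Otherwise the remaining name also completes `x` and `z`, hence has the value of `x`.
    repeated : ∀ x z → ⟦ x ⟧ + ⟦ x ⟧ + ⟦ z ⟧ ≈ 2 · π → x ≡ α
    repeated x z xxz with x ≟ₐ α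
    ... | yes x≡α = x≡α
    ... | no  x≢α with x ≟ₐ z | z ≟ₐ α
    ... | yes refl | _ = ⟦⟧-injective (·-cancel 2 (≈-trans (triple x) (≈-trans xxz (≈-sym 3α))))
      where
      triple : ∀ x → 3 · ⟦ x ⟧ ≈ ⟦ x ⟧ + ⟦ x ⟧ + ⟦ x ⟧
      triple x = ≈-trans (+-congˡ (+-congˡ (+-identityʳ _))) (≈-sym (+-assoc _ _ _))
    ... | no _ | yes refl = ⟦⟧-injective (·-cancel 1 (≈-trans (double x) (≈-trans
        (+-cancelʳ _ _ _ (≈-trans xxz (≈-sym ααα))) (≈-sym (double α)))))
      where
      double : ∀ x → 2 · ⟦ x ⟧ ≈ ⟦ x ⟧ + ⟦ x ⟧
      double x = +-congˡ (+-identityʳ _)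
    ... | no x≢z | no z≢α with third-sum x z x≢α z≢α x≢z
    ... | w , (_ , w≢x) , xzw = contradiction
      (⟦⟧-injective (+-cancelˡ _ _ _ (≈-trans xzw (≈-sym (transpose xxz))))) w≢x

    -- If `y` and `z` are distinct and neither is `α`, the remaining name completes them as `α`
    -- does, against injectivity.
    beside-α : ∀ y z → ⟦ α ⟧ + ⟦ y ⟧ + ⟦ z ⟧ ≈ 2 · π → y ≡ α
    beside-α y z αyz with y ≟ₐ α | z ≟ₐ α | y ≟ₐ z
    ... | yes y≡α | _ | _ = y≡α
    ... | no _ | yes refl | _ = ⟦⟧-injective (+-cancelˡ _ _ _ (≈-trans (transpose αyz) (≈-sym ααα)))
    ... | no _ | no _ | yes refl = repeated y α (rotate αyz)
    ... | no y≢α | no z≢α | no y≢z with third-sum y z y≢α z≢α y≢z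
    ... | w , (w≢α , _) , yzw = contradiction
      (⟦⟧-injective (+-cancelˡ _ _ _ (≈-trans yzw (≈-sym (rotate αyz))))) w≢α

    vertex-good : ∀ x y z → ⟦ x ⟧ + ⟦ y ⟧ + ⟦ z ⟧ ≈ 2 · π → Good x y
    vertex-good x y z xyz =
      (λ { refl → beside-α y z xyz }) ,
      (λ { refl → beside-α x z (transpose (rotate xyz)) }) ,
      (λ { refl → repeated x z xyz })

    exchanged-tiling : ∀ S → IsTiling ⟦_⟧ (evaluate ⟦_⟧ (exchanged S))
    exchanged-tiling S = record
      { vertex    = vertex
      ; congruent = λ i j → Product.map₂
          (λ eq k → Sum.map (Product.map₂ ⟦⟧-cong) (Product.map₂ ⟦⟧-cong) (eq k))
          (exchanged-congruent S i j)
      ; angles    = λ i → Product.map₂ (λ {f} eq k → ≈-trans (⟦⟧-cong (eq k)) (names-lookup (f ⟨$⟩ʳ k)))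
          (exchanged-arrangement S i)
      }
      where
      vertex : ∀ i j l k m n → At i j l k → At j l i m → At l i j n →
        ⟦ exchanged S i k ⟧ + ⟦ exchanged S j m ⟧ + ⟦ exchanged S l n ⟧ ≈ 2 · π
      vertex i j l k m n at-k at-m at-n
        with across-unique at-k at-m | across-unique at-m at-n
      ... | refl | refl = All.lookup balanced-sum (exchanged-vertex S i k)

  -- From angle values to names.

  tiling-labelled : ∀ A → IsTiling ⟦_⟧ A → ∃ λ S → GivenUpToSymmetry ⟦_⟧ (exchanged S) A
  tiling-labelled A tiling = given (arrangement-form (proj₁ (angles P₁)))
    where
    open IsTiling tiling

    L : Labelling
    L i k = names (proj₁ (angles i) ⟨$⟩ʳ k)

    A≈L : ∀ i k → A i k ≈ ⟦ L i k ⟧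
    A≈L i k = ≈-trans (proj₂ (angles i) k) (≈-sym (names-lookup (proj₁ (angles i) ⟨$⟩ʳ k)))

    label : ∀ {i k j m} → A i k ≈ A j m → L i k ≡ L j m
    label eq = ⟦⟧-injective (≈-trans (≈-sym (A≈L _ _)) (≈-trans eq (A≈L _ _)))

    congruent-words : ∀ i j → CongruentWords (L i) (L j)
    congruent-words i j = Product.map₂
      (λ eq k → Sum.map (Product.map₂ label) (Product.map₂ label) (eq k)) (congruent i j)

    tile-sum : ∀ i → ∑[ k < 5 ] A i k ≈ total
    tile-sum i = ≈-trans (sum-cong-≋ (proj₂ (angles i))) (≈-sym (sum-permute
      (lookup (⟦ α ⟧ ∷ ⟦ α ⟧ ∷ ⟦ β ⟧ ∷ ⟦ γ ⟧ ∷ ⟦ δ ⟧ ∷ [])) (proj₁ (angles i))))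

    vertex-sum : ∀ p → uncurry A p + uncurry A (across p) + uncurry A (across (across p)) ≈ 2 · π
    vertex-sum (i , k) = let at-k , at-m , at-n = At-across i k in vertex _ _ _ _ _ _ at-k at-m at-n

    good : ∀ i k → Good (L i k) (L (nbr i k) (opp i k))
    good i k = vertex-good (angle-sum A vertex-sum tile-sum) _ _ _
      (≈-trans (≈-sym (+-cong (+-cong (A≈L _ _) (A≈L _ _)) (A≈L _ _))) (vertex-sum (i , k)))

    given : (∃ λ φ → ∀ k → L P₁ k ≡ read φ k) →
      ∃ λ S → GivenUpToSymmetry ⟦_⟧ (exchanged S) A
    given (form κ r b d , L₁≗) =
      Product.map₂ (Product.map₂ λ L≗ → r , λ i k → ≈-trans (A≈L i k) (⟦⟧-cong (L≗ i k)))
        (labelling good κ r (proj₁ ∘ forms-of) (proj₁ ∘ proj₂ ∘ forms-of) (λ i → proj₂ (proj₂ (forms-of i))))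
      where
      forms-of : ∀ i → ∃ λ b → ∃ λ d → ∀ k → L i k ≡ read (form κ r b d) k
      -- Comparing every tile with `P₁` gives all of them one kind and one naming.
      forms-of i = congruent-form (congruent-words i P₁) κ r b d L₁≗

proposition19 : {c ℓ₁ ℓ₂ : Level} (F : HeytingField c ℓ₁ ℓ₂) → CharacteristicZero F →
    let open HeytingField F in
    (π : Carrier) (⟦_⟧ : Angle → Carrier) →
    let open Tilings F π in
    3 · ⟦ α ⟧ ≈ 2 · π →
    Injective _≡_ _≈_ ⟦_⟧ →
    (∀ A → IsTiling ⟦_⟧ A → ∃ λ (S : Vec Bool 6) → GivenUpToSymmetry ⟦_⟧ (exchanged S) A)
    ×
    (⟦ β ⟧ + ⟦ γ ⟧ + ⟦ δ ⟧ ≈ 2 · π → ∀ (S : Vec Bool 6) → IsTiling ⟦_⟧ (evaluate ⟦_⟧ (exchanged S)))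
proposition19 F char0 π ⟦_⟧ 3α inj =
  tiling-labelled , exchanged-tiling
  where
  open Angles F char0 π ⟦_⟧ 3α inj
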